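{- Let $n\geq 0$ be an integer. (1) Let $(I,+_I,\preceq_I,J,+_J,\preceq_J,K,+_K,\preceq_K,\ast)\in\mathcal{C}$ with $I=J$ and $\preceq_I=\preceq_J$, and suppose $K$ is a partially ordered real vector space. Let $x,y,z\in I$ with $x\succeq_I y\succeq_I z$ and let $a,b,c\in\mathbb{R}$ with $a,c\geq 0$ and $a+c\geq |b|$. Then $$a\,(x-_I y)\ast(x-_J z) + b\,(y-_I x)\ast(y-_J z) + c\,(z-_I x)\ast(z-_J y)\succeq_K 0.$$ (2) Let $(I,+,\preceq_I,\ast)\in\mathcal{C}_2$, let $x,y,z\in I$ with $x\succeq_I y\succeq_I z$, and let $a,b,c\in I$ be such that $a\succeq_I 0$, $c\succeq_I 0$, and $a+c$ is an upper bound of $\{b,-b\}$. Then $$a\ast(x-y)^n\ast(x-z)^n + b\ast(y-x)^n\ast(y-z)^n + c\ast(z-x)^n\ast(z-y)^n\succeq_I 0.$$ (3) Let $(I,+,\preceq_I,\ast)\in\mathcal{C}_2$ where $I$ is a partially ordered real vector space, let $x,y,z\in I$ with $x\succeq_I y\succeq_I z$, let $a,b,c\in I$ be such that $a\succeq_I 0$, $c\succeq_I 0$, and $a+c$ is an upper bound of $\{b,-b\}$, and let $p:I\to I$ be in class $\mathcal{G}$. Then $$a\ast p(x-y)\ast p(x-z) + b\ast p(y-x)\ast p(y-z) + c\ast p(z-x)\ast p(z-y)\succeq_I 0.$$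
   Context: A partially ordered group $(G,+,\preceq)$ is a group $(G,+)$ with a partial order $\preceq$ such that $z+x\preceq z+y\Leftrightarrow x+z\preceq y+z\Leftrightarrow x\preceq y$ for all $x,y,z\in G$. $(G,+,\preceq)$ is a partially ordered real vector space if $(G,+,\preceq)$ is a partially ordered group, $G$ is a real vector space, and $x\preceq y$ implies $\lambda x\preceq\lambda y$ for all real $\lambda\geq 0$. $\mathcal{C}$ is the set of tuples $(I,+_I,\preceq_I,J,+_J,\preceq_J,K,+_K,\preceq_K,\ast)$ such that: (i) $(I,+_I,\preceq_I)$, $(J,+_J,\preceq_J)$, $(K,+_K,\preceq_K)$ are partially ordered Abelian groups; (ii) $\ast:I\times J\to K$ is distributive: $(x+_I y)\ast z = x\ast z+_K y\ast z$ and $x\ast(y+_J z)=x\ast y+_K x\ast z$; (iii) $\ast$ is nonnegativity-preserving: $x\succeq_I 0$ and $y\succeq_J 0$ imply $x\ast y\succeq_K 0$. Here $-_I$, $-_J$ denote subtraction in $(I,+_I)$, $(J,+_J)$. $\mathcal{C}_2$ is the set of tuples $(I,+,\preceq_I,\ast)$ such that $(I,+,\preceq_I,I,+,\preceq_I,I,+,\preceq_I,\ast)\in\mathcal{C}$. For $x\in I$, $x^n$ denotes the $n$-fold product $x\ast x\ast\cdots\ast x$ (for $n=0$, the identity of $\ast$ when it exists). The operation $\ast$ need not be associative or commutative; if it is not associative, the products in the three terms of each inequality are understood to be bracketed in the same fixed way. In a partially ordered set $(I,\preceq_I)$, $u$ is an upper bound of $S\subset I$ if $u\succeq_I s$ for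 all $s\in S$. A function $p:I\to I$ is in class $\mathcal{G}$ if $p(0)\succeq_I 0$; $x\succeq_I y\succeq_I 0$ implies $p(x)\succeq_I p(y)$; and either $p(x)=p(-x)$ for all $x\in I$ or $p(x)=-p(-x)$ for all $x\in I$. -}

module Defs where

open import Algebra.Bundles using (Ring; CommutativeRing)
open import Algebra.Core using (Op₁; Op₂)
open import Algebra.Definitions using (Identity; Commutative; Congruent₁)
open import Algebra.Module.Structures using (IsLeftModule)
import Algebra.Properties.CommutativeSemigroup as CommutativeSemigroupProperties
import Algebra.Properties.Group as GroupProperties
open import Algebra.Structures using (IsGroup)
open import Data.Nat.Base as ℕ using (ℕ; zero; suc)
import Data.Nat.Properties as ℕ
open import Data.Product.Base using (Σ; ∃; _×_; _,_; proj₁; proj₂)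
open import Data.Rational.Base using (ℚ; 0ℚ; 1ℚ; ½; _+_; _*_; -_; _-_; ∣_∣; _<_; _≤_; 1/_; Positive; positive)
import Data.Rational.Properties as ℚ
open import Data.Sum.Base using (_⊎_; inj₁; inj₂)
open import Data.Unit.Polymorphic.Base using (⊤)
open import Data.Vec.Base using (Vec; []; _∷_; take; drop; replicate)
open import Function.Base using (flip)
open import Function.Bundles using (_⇔_)
open import Level using (0ℓ; _⊔_)
open import Relation.Binary.Bundles using (Poset)
open import Relation.Binary.Core using (Rel)
open import Relation.Binary.PropositionalEquality using (_≡_; refl; sym; trans; cong; cong₂; subst)
open import Relation.Unary using (Pred)

-- f m n → 0 as m, n → ∞ jointly.
Vanishing : (ℕ → ℕ → ℚ) → Set
Vanishing f = ∀ ε → 0ℚ < ε → ∃ λ N → ∀ m n → N ℕ.≤ m → N ℕ.≤ n → ∣ f m n ∣ < ε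

EventuallyBounded : (ℕ → ℕ → ℚ) → Set
EventuallyBounded f = ∃ λ B → 0ℚ < B × ∃ λ N → ∀ m n → N ℕ.≤ m → N ℕ.≤ n → ∣ f m n ∣ ≤ B

-- Cauchy sequences of rationals; the quotient by null sequences is taken by
-- using _≃ℝ_ as the equality of ℝ.
record ℝ : Set where
  constructor mkℝ
  field
    seq    : ℕ → ℚ
    cauchy : Vanishing λ m n → seq m - seq n

open ℝ public

infix 4 _≃ℝ_ _≤ℝ_

_≃ℝ_ : Rel ℝ 0ℓ
x ≃ℝ y = Vanishing λ n _ → seq x n - seq y n

-- liminf (y - x) ≥ 0, so that two sequences with the same limit are
-- comparable both ways.
_≤ℝ_ : Rel ℝ 0ℓ
x ≤ℝ y = ∀ ε → 0ℚ < ε → ∃ λ N → ∀ n → N ℕ.≤ n → seq x n ≤ seq y n + ε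

private
  open GroupProperties ℚ.+-0-group using (⁻¹-involutive)
  open CommutativeSemigroupProperties (CommutativeRing.+-commutativeSemigroup ℚ.+-*-commutativeRing)
    using (interchange)

  p-q+q≡p : ∀ p q → (p - q) + q ≡ p
  p-q+q≡p p q = trans (ℚ.+-assoc p (- q) q)
    (trans (cong (p +_) (ℚ.+-inverseˡ q)) (ℚ.+-identityʳ p))

  p+q-q≡p : ∀ p q → (p + q) - q ≡ p
  p+q-q≡p p q = trans (ℚ.+-assoc p q (- q))
    (trans (cong (p +_) (ℚ.+-inverseʳ q)) (ℚ.+-identityʳ p))

  -[p-q]≡q-p : ∀ p q → - (p - q) ≡ q - p
  -[p-q]≡q-p p q = trans (ℚ.neg-distrib-+ p (- q))
    (trans (cong ((- p) +_) (⁻¹-involutive q)) (ℚ.+-comm (- p) q))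

  p-q≡-[q-p] : ∀ p q → p - q ≡ - (q - p)
  p-q≡-[q-p] p q = sym (-[p-q]≡q-p q p)

  -p--q : ∀ p q → (- p) - (- q) ≡ - (p - q)
  -p--q p q = sym (ℚ.neg-distrib-+ p (- q))

  p-r≡[p-q]+[q-r] : ∀ p q r → p - r ≡ (p - q) + (q - r)
  p-r≡[p-q]+[q-r] p q r = trans (cong (_- r) (sym (p-q+q≡p p q))) (ℚ.+-assoc (p - q) q (- r))

  [p+q]-[r+s] : ∀ p q r s → (p + q) - (r + s) ≡ (p - r) + (q - s)
  [p+q]-[r+s] p q r s = trans (cong ((p + q) +_) (ℚ.neg-distrib-+ r s))
    (interchange p q (- r) (- s))

  p[q-r]≡pq-pr : ∀ p q r → p * (q - r) ≡ p * q - p * r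
  p[q-r]≡pq-pr p q r = trans (ℚ.*-distribˡ-+ p q (- r))
    (cong (p * q +_) (sym (ℚ.neg-distribʳ-* p r)))

  pq-rs : ∀ p q r s → p * q - r * s ≡ p * (q - s) + s * (p - r)
  pq-rs p q r s = trans (p-r≡[p-q]+[q-r] (p * q) (p * s) (r * s))
    (cong₂ _+_ (sym (p[q-r]≡pq-pr p q s))
      (sym (trans (p[q-r]≡pq-pr s p r) (cong₂ _-_ (ℚ.*-comm s p) (ℚ.*-comm s r)))))

  vanishing-≤ : ∀ {f g} → (∀ m n → ∣ f m n ∣ ≤ ∣ g m n ∣) → Vanishing g → Vanishing f
  vanishing-≤ f≤g vg ε ε>0 with vg ε ε>0
  ... | N , g<ε = N , λ m n N≤m N≤n → ℚ.≤-<-trans (f≤g m n) (g<ε m n N≤m N≤n)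

  vanishing-≡ : ∀ {f g} → (∀ m n → f m n ≡ g m n) → Vanishing g → Vanishing f
  vanishing-≡ f≡g = vanishing-≤ λ m n → ℚ.≤-reflexive (cong ∣_∣ (f≡g m n))

  vanishing-0 : Vanishing λ _ _ → 0ℚ
  vanishing-0 ε ε>0 = 0 , λ _ _ _ _ → ε>0

  vanishing-neg : ∀ {f} → Vanishing f → Vanishing λ m n → - f m n
  vanishing-neg {f} = vanishing-≤ λ m n → ℚ.≤-reflexive (ℚ.∣-p∣≡∣p∣ (f m n))

  *-pos : ∀ r .{{_ : Positive r}} {ε} → 0ℚ < ε → 0ℚ < r * ε
  *-pos r {ε} ε>0 = subst (_< r * ε) (ℚ.*-zeroʳ r) (ℚ.*-monoʳ-<-pos r ε>0)

  halves : ∀ ε → ½ * ε + ½ * ε ≡ ε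
  halves ε = trans (sym (ℚ.*-distribʳ-+ ε ½ ½)) (ℚ.*-identityˡ ε)

  vanishing-+ : ∀ {f g} → Vanishing f → Vanishing g → Vanishing λ m n → f m n + g m n
  vanishing-+ {f} {g} vf vg ε ε>0 with vf (½ * ε) (*-pos ½ ε>0) | vg (½ * ε) (*-pos ½ ε>0)
  ... | M , f<ε | N , g<ε = M ℕ.⊔ N , λ m n p q →
    subst (∣ f m n + g m n ∣ <_) (halves ε)
      (ℚ.≤-<-trans (ℚ.∣p+q∣≤∣p∣+∣q∣ (f m n) (g m n))
        (ℚ.+-mono-< (f<ε m n (ℕ.m⊔n≤o⇒m≤o M N p) (ℕ.m⊔n≤o⇒m≤o M N q))
                    (g<ε m n (ℕ.m⊔n≤o⇒n≤o M N p) (ℕ.m⊔n≤o⇒n≤o M N q))))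

  vanishing-* : ∀ {b f} → EventuallyBounded b → Vanishing f → Vanishing λ m n → b m n * f m n
  vanishing-* {b} {f} (B , B>0 , M , b≤B) vf ε ε>0 = go (vf (1/B * ε) δ>0)
    where
    instance
      B⁺ : Positive B
      B⁺ = positive B>0
      B≢0 = ℚ.pos⇒nonZero B
    1/B : ℚ
    1/B = 1/ B
    instance
      1/B⁺ : Positive 1/B
      1/B⁺ = ℚ.1/pos⇒pos B
    δ>0 : 0ℚ < 1/B * ε
    δ>0 = *-pos 1/B ε>0
    B*δ≡ε : B * (1/B * ε) ≡ ε
    B*δ≡ε = trans (sym (ℚ.*-assoc B 1/B ε))
              (trans (cong (_* ε) (ℚ.*-inverseʳ B)) (ℚ.*-identityˡ ε))
    go : (∃ λ N → ∀ m n → N ℕ.≤ m → N ℕ.≤ n → ∣ f m n ∣ < 1/B * ε) →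
         ∃ λ N → ∀ m n → N ℕ.≤ m → N ℕ.≤ n → ∣ b m n * f m n ∣ < ε
    go (N , f<δ) = M ℕ.⊔ N , λ m n p q →
      ℚ.≤-<-trans (ℚ.≤-reflexive (ℚ.∣p*q∣≡∣p∣*∣q∣ (b m n) (f m n)))
        (ℚ.≤-<-trans
          (ℚ.*-monoʳ-≤-nonNeg ∣ f m n ∣ {{ℚ.∣-∣-nonNeg (f m n)}}
            (b≤B m n (ℕ.m⊔n≤o⇒m≤o M N p) (ℕ.m⊔n≤o⇒m≤o M N q)))
          (subst (B * ∣ f m n ∣ <_) B*δ≡ε
            (ℚ.*-monoʳ-<-pos B (f<δ m n (ℕ.m⊔n≤o⇒n≤o M N p) (ℕ.m⊔n≤o⇒n≤o M N q)))))

  bounded : ∀ x → ∃ λ B → 0ℚ < B × ∃ λ N → ∀ n → N ℕ.≤ n → ∣ seq x n ∣ ≤ B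
  bounded x with cauchy x 1ℚ (ℚ.positive⁻¹ 1ℚ)
  ... | N , close = 1ℚ + ∣ seq x N ∣ , ℚ.<-≤-trans (ℚ.positive⁻¹ 1ℚ) 1≤B , N , λ n N≤n →
    ℚ.≤-trans (ℚ.≤-reflexive (cong ∣_∣ (sym (p-q+q≡p (seq x n) (seq x N)))))
      (ℚ.≤-trans (ℚ.∣p+q∣≤∣p∣+∣q∣ (seq x n - seq x N) (seq x N))
        (ℚ.+-monoˡ-≤ ∣ seq x N ∣ (ℚ.<⇒≤ (close n N N≤n ℕ.≤-refl))))
    where
    1≤B : 1ℚ ≤ 1ℚ + ∣ seq x N ∣
    1≤B = subst (_≤ 1ℚ + ∣ seq x N ∣) (ℚ.+-identityʳ 1ℚ) (ℚ.+-monoʳ-≤ 1ℚ (ℚ.0≤∣p∣ (seq x N)))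

  boundedˡ : ∀ x → EventuallyBounded λ m _ → seq x m
  boundedˡ x with bounded x
  ... | B , B>0 , N , x≤B = B , B>0 , N , λ m _ N≤m _ → x≤B m N≤m

  boundedʳ : ∀ x → EventuallyBounded λ _ n → seq x n
  boundedʳ x with bounded x
  ... | B , B>0 , N , x≤B = B , B>0 , N , λ _ n _ N≤n → x≤B n N≤n

  ∣p∣-∣q∣≤∣p-q∣ : ∀ p q → ∣ p ∣ - ∣ q ∣ ≤ ∣ p - q ∣
  ∣p∣-∣q∣≤∣p-q∣ p q = subst (∣ p ∣ - ∣ q ∣ ≤_) (p+q-q≡p ∣ p - q ∣ ∣ q ∣)
    (ℚ.+-monoˡ-≤ (- ∣ q ∣)
      (ℚ.≤-trans (ℚ.≤-reflexive (cong ∣_∣ (sym (p-q+q≡p p q)))) (ℚ.∣p+q∣≤∣p∣+∣q∣ (p - q) q)))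

  reverse-triangle : ∀ p q → ∣ ∣ p ∣ - ∣ q ∣ ∣ ≤ ∣ p - q ∣
  reverse-triangle p q with ℚ.∣p∣≡p∨∣p∣≡-p (∣ p ∣ - ∣ q ∣)
  ... | inj₁ eq = subst (_≤ ∣ p - q ∣) (sym eq) (∣p∣-∣q∣≤∣p-q∣ p q)
  ... | inj₂ eq = subst (_≤ ∣ p - q ∣) (sym (trans eq (-[p-q]≡q-p ∣ p ∣ ∣ q ∣)))
                    (subst (∣ q ∣ - ∣ p ∣ ≤_)
                      (trans (cong ∣_∣ (sym (-[p-q]≡q-p p q))) (ℚ.∣-p∣≡∣p∣ (p - q)))
                      (∣p∣-∣q∣≤∣p-q∣ q p))

infixl 7 _*ℝ_
infixl 6 _+ℝ_
infix  8 -ℝ_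

fromℚ : ℚ → ℝ
fromℚ q = mkℝ (λ _ → q) (vanishing-≡ (λ _ _ → ℚ.+-inverseʳ q) vanishing-0)

0ℝ 1ℝ : ℝ
0ℝ = fromℚ 0ℚ
1ℝ = fromℚ 1ℚ

_+ℝ_ : Op₂ ℝ
x +ℝ y = mkℝ (λ n → seq x n + seq y n)
  (vanishing-≡ (λ m n → [p+q]-[r+s] (seq x m) (seq y m) (seq x n) (seq y n))
    (vanishing-+ (cauchy x) (cauchy y)))

-ℝ_ : Op₁ ℝ
-ℝ x = mkℝ (λ n → - seq x n)
  (vanishing-≡ (λ m n → -p--q (seq x m) (seq x n)) (vanishing-neg (cauchy x)))

_*ℝ_ : Op₂ ℝ
x *ℝ y = mkℝ (λ n → seq x n * seq y n)
  (vanishing-≡ (λ m n → pq-rs (seq x m) (seq y m) (seq x n) (seq y n))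
    (vanishing-+ (vanishing-* (boundedˡ x) (cauchy y)) (vanishing-* (boundedʳ y) (cauchy x))))

∣_∣ℝ : Op₁ ℝ
∣ x ∣ℝ = mkℝ (λ n → ∣ seq x n ∣)
  (vanishing-≤ (λ m n → reverse-triangle (seq x m) (seq x n)) (cauchy x))

private
  pointwise : ∀ {x y} → (∀ n → seq x n ≡ seq y n) → x ≃ℝ y
  pointwise {x} {y} x≡y = vanishing-≡
    (λ n _ → trans (cong (_- seq y n) (x≡y n)) (ℚ.+-inverseʳ (seq y n))) vanishing-0

  ≃ℝ-sym : ∀ {x y} → x ≃ℝ y → y ≃ℝ x
  ≃ℝ-sym {x} {y} x≃y = vanishing-≡ (λ n _ → p-q≡-[q-p] (seq y n) (seq x n)) (vanishing-neg x≃y)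

  ≃ℝ-trans : ∀ {x y z} → x ≃ℝ y → y ≃ℝ z → x ≃ℝ z
  ≃ℝ-trans {x} {y} {z} x≃y y≃z = vanishing-≡
    (λ n _ → p-r≡[p-q]+[q-r] (seq x n) (seq y n) (seq z n)) (vanishing-+ x≃y y≃z)

  +ℝ-cong : ∀ {x x′ y y′} → x ≃ℝ x′ → y ≃ℝ y′ → x +ℝ y ≃ℝ x′ +ℝ y′
  +ℝ-cong {x} {x′} {y} {y′} p q = vanishing-≡
    (λ n _ → [p+q]-[r+s] (seq x n) (seq y n) (seq x′ n) (seq y′ n)) (vanishing-+ p q)

  -ℝ-cong : ∀ {x y} → x ≃ℝ y → -ℝ x ≃ℝ -ℝ y
  -ℝ-cong {x} {y} p = vanishing-≡ (λ n _ → -p--q (seq x n) (seq y n)) (vanishing-neg p)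

  *ℝ-cong : ∀ {x x′ y y′} → x ≃ℝ x′ → y ≃ℝ y′ → x *ℝ y ≃ℝ x′ *ℝ y′
  *ℝ-cong {x} {x′} {y} {y′} p q = vanishing-≡
    (λ n _ → pq-rs (seq x n) (seq y n) (seq x′ n) (seq y′ n))
    (vanishing-+ (vanishing-* (boundedˡ x) q) (vanishing-* (boundedˡ y′) p))

ℝ-commutativeRing : CommutativeRing 0ℓ 0ℓ
ℝ-commutativeRing = record
  { Carrier = ℝ
  ; _≈_ = _≃ℝ_
  ; _+_ = _+ℝ_
  ; _*_ = _*ℝ_
  ; -_ = -ℝ_
  ; 0# = 0ℝ
  ; 1# = 1ℝ
  ; isCommutativeRing = record
    { isRing = record
      { +-isAbelianGroup = record
        { isGroup = record
          { isMonoid = record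
            { isSemigroup = record
              { isMagma = record
                { isEquivalence = record
                  { refl  = λ {x} → pointwise {x} {x} λ _ → refl
                  ; sym   = λ {x} {y} → ≃ℝ-sym {x} {y}
                  ; trans = λ {x} {y} {z} → ≃ℝ-trans {x} {y} {z}
                  }
                ; ∙-cong = λ {x} {x′} {y} {y′} → +ℝ-cong {x} {x′} {y} {y′}
                }
              ; assoc = λ x y z → pointwise {(x +ℝ y) +ℝ z} {x +ℝ (y +ℝ z)}
                  λ n → ℚ.+-assoc (seq x n) (seq y n) (seq z n)
              }
            ; identity = (λ x → pointwise {0ℝ +ℝ x} {x} λ n → ℚ.+-identityˡ (seq x n))
                       , (λ x → pointwise {x +ℝ 0ℝ} {x} λ n → ℚ.+-identityʳ (seq x n))
            }
          ; inverse = (λ x → pointwise {(-ℝ x) +ℝ x} {0ℝ} λ n → ℚ.+-inverseˡ (seq x n))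
                    , (λ x → pointwise {x +ℝ (-ℝ x)} {0ℝ} λ n → ℚ.+-inverseʳ (seq x n))
          ; ⁻¹-cong = λ {x} {y} → -ℝ-cong {x} {y}
          }
        ; comm = λ x y → pointwise {x +ℝ y} {y +ℝ x} λ n → ℚ.+-comm (seq x n) (seq y n)
        }
      ; *-cong = λ {x} {x′} {y} {y′} → *ℝ-cong {x} {x′} {y} {y′}
      ; *-assoc = λ x y z → pointwise {(x *ℝ y) *ℝ z} {x *ℝ (y *ℝ z)}
          λ n → ℚ.*-assoc (seq x n) (seq y n) (seq z n)
      ; *-identity = (λ x → pointwise {1ℝ *ℝ x} {x} λ n → ℚ.*-identityˡ (seq x n))
                   , (λ x → pointwise {x *ℝ 1ℝ} {x} λ n → ℚ.*-identityʳ (seq x n))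
      ; distrib = (λ x y z → pointwise {x *ℝ (y +ℝ z)} {(x *ℝ y) +ℝ (x *ℝ z)}
                    λ n → ℚ.*-distribˡ-+ (seq x n) (seq y n) (seq z n))
                , (λ x y z → pointwise {(y +ℝ z) *ℝ x} {(y *ℝ x) +ℝ (z *ℝ x)}
                    λ n → ℚ.*-distribʳ-+ (seq x n) (seq y n) (seq z n))
      }
    ; *-comm = λ x y → pointwise {x *ℝ y} {y *ℝ x} λ n → ℚ.*-comm (seq x n) (seq y n)
    }
  }

ℝ-ring : Ring 0ℓ 0ℓ
ℝ-ring = CommutativeRing.ring ℝ-commutativeRing

-- Group structures on a given poset, so that two of them can share their
-- underlying ordered set.
record PartiallyOrderedGroup {c ℓ₁ ℓ₂} (P : Poset c ℓ₁ ℓ₂) : Set (c ⊔ ℓ₁ ⊔ ℓ₂) where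
  open Poset P public using (Carrier; _≈_) renaming (_≤_ to _≼_)
  infixl 6 _⊕_ _⊖_
  infix  8 ⊝_
  infix  4 _≽_
  field
    _⊕_     : Op₂ Carrier
    𝟎       : Carrier
    ⊝_      : Op₁ Carrier
    isGroup : IsGroup _≈_ _⊕_ 𝟎 ⊝_
    translateˡ⇔translateʳ : ∀ x y z → (z ⊕ x ≼ z ⊕ y) ⇔ (x ⊕ z ≼ y ⊕ z)
    translateʳ⇔≼          : ∀ x y z → (x ⊕ z ≼ y ⊕ z) ⇔ (x ≼ y)

  _⊖_ : Op₂ Carrier
  x ⊖ y = x ⊕ (⊝ y)

  _≽_ : Rel Carrier ℓ₂
  _≽_ = flip _≼_

record PartiallyOrderedAbelianGroup {c ℓ₁ ℓ₂} (P : Poset c ℓ₁ ℓ₂) : Set (c ⊔ ℓ₁ ⊔ ℓ₂) where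
  field
    partiallyOrderedGroup : PartiallyOrderedGroup P
  open PartiallyOrderedGroup partiallyOrderedGroup public
  field
    ⊕-comm : Commutative _≈_ _⊕_

-- Over the field ℝ, left modules are vector spaces.
record IsPartiallyOrderedRealVectorSpace
    {c ℓ₁ ℓ₂} {P : Poset c ℓ₁ ℓ₂} (G : PartiallyOrderedGroup P)
    (_·_ : ℝ → Poset.Carrier P → Poset.Carrier P) : Set (c ⊔ ℓ₁ ⊔ ℓ₂) where
  open PartiallyOrderedGroup G
  field
    isRealVectorSpace : IsLeftModule ℝ-ring _≈_ _⊕_ 𝟎 ⊝_ _·_
    ·-monoʳ           : ∀ r x y → 0ℝ ≤ℝ r → x ≼ y → (r · x) ≼ (r · y)

-- Equality in a poset is its setoid equality, so the maps ∗ and p below are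
-- functions on the underlying sets only if they respect it.

record Is𝒞 {i iℓ io j jℓ jo k kℓ ko}
    {I : Poset i iℓ io} {J : Poset j jℓ jo} {K : Poset k kℓ ko}
    (GI : PartiallyOrderedAbelianGroup I)
    (GJ : PartiallyOrderedAbelianGroup J)
    (GK : PartiallyOrderedAbelianGroup K)
    (_∗_ : Poset.Carrier I → Poset.Carrier J → Poset.Carrier K)
    : Set (i ⊔ iℓ ⊔ io ⊔ j ⊔ jℓ ⊔ jo ⊔ k ⊔ kℓ ⊔ ko) where
  private
    module I = PartiallyOrderedAbelianGroup GI
    module J = PartiallyOrderedAbelianGroup GJ
    module K = PartiallyOrderedAbelianGroup GK
  field
    ∗-cong     : ∀ {x x′ y y′} → x I.≈ x′ → y J.≈ y′ → (x ∗ y) K.≈ (x′ ∗ y′)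
    ∗-distribʳ : ∀ x y z → ((x I.⊕ y) ∗ z) K.≈ ((x ∗ z) K.⊕ (y ∗ z))
    ∗-distribˡ : ∀ x y z → (x ∗ (y J.⊕ z)) K.≈ ((x ∗ y) K.⊕ (x ∗ z))
    ∗-nonNeg   : ∀ x y → x I.≽ I.𝟎 → y J.≽ J.𝟎 → (x ∗ y) K.≽ K.𝟎

Is𝒞₂ : ∀ {i iℓ io} {I : Poset i iℓ io} →
       PartiallyOrderedAbelianGroup I → Op₂ (Poset.Carrier I) → Set (i ⊔ iℓ ⊔ io)
Is𝒞₂ G _∗_ = Is𝒞 G G G _∗_

record Is𝒢 {i iℓ io} {I : Poset i iℓ io} (G : PartiallyOrderedGroup I)
    (p : Op₁ (Poset.Carrier I)) : Set (i ⊔ iℓ ⊔ io) where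
  open PartiallyOrderedGroup G
  field
    p-cong : Congruent₁ _≈_ p
    p0≽0   : p 𝟎 ≽ 𝟎
    p-mono : ∀ x y → x ≽ y → y ≽ 𝟎 → p x ≽ p y
    parity : (∀ x → p x ≈ p (⊝ x)) ⊎ (∀ x → p x ≈ (⊝ p (⊝ x)))

IsUpperBound : ∀ {c ℓ₁ ℓ₂ ℓ} (P : Poset c ℓ₁ ℓ₂) →
               Pred (Poset.Carrier P) ℓ → Poset.Carrier P → Set (c ⊔ ℓ₂ ⊔ ℓ)
IsUpperBound P S u = ∀ s → S s → Poset._≤_ P s u

data Bracketing : ℕ → Set where
  leaf : Bracketing 1
  node : ∀ {m n} → Bracketing m → Bracketing n → Bracketing (m ℕ.+ n)

product : ∀ {a n} {A : Set a} → Op₂ A → Bracketing n → Vec A n → A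
product _∗_ leaf               (x ∷ []) = x
product _∗_ (node {m} {n} s t) xs       = product _∗_ s (take m xs) ∗ product _∗_ t (drop m xs)

module _ {a ℓ} {A : Set a} (_≈_ : Rel A ℓ) (_∗_ : Op₂ A) where

  -- What is needed for nth powers to make sense: an identity if n = 0.
  HasPower : ℕ → Set (a ⊔ ℓ)
  HasPower zero    = Σ A λ e → Identity _≈_ e _∗_
  HasPower (suc _) = ⊤

-- The number of factors that xⁿ contributes to a product (x⁰ is the single
-- factor e), and these factors.  Powers are kept as lists of factors because
-- the bracketing is chosen for the product as a whole.
width : ℕ → ℕ
width zero    = 1
width (suc n) = suc n

power : ∀ {a ℓ} {A : Set a} (_≈_ : Rel A ℓ) (_∗_ : Op₂ A) n →
        HasPower _≈_ _∗_ n → A → Vec A (width n)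
power _ _ zero    (e , _) _ = e ∷ []
power _ _ (suc n) _       x = replicate (suc n) x

{-# OPTIONS --safe #-}
-- Put W = (x − y) ∗ (y − z).  The first term of (1) is at least a W, the last
-- is at least c W, and the middle one is − b W, so the sum is at least
-- (a + c − b) W ≽ 0.  For (2) and (3) the same comparison is carried through an
-- arbitrary bracketing by an invariant of the three products jointly.
module Submission where

open import Defs
open import Algebra.Bundles using (AbelianGroup; CommutativeRing; Group)
open import Algebra.Core using (Op₁; Op₂)
open import Algebra.Definitions using (Identity)
open import Algebra.Module.Structures using (IsLeftModule)
open import Algebra.Morphism.Definitions using (Homomorphic₂)
import Algebra.Properties.AbelianGroup as AbelianGroupProperties
import Algebra.Properties.CommutativeSemigroup as CommutativeSemigroupProperties
import Algebra.Properties.Group as GroupProperties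
import Algebra.Properties.Monoid.Mult as Mult
open import Data.Empty using (⊥-elim)
open import Data.Nat.Base as ℕ using (ℕ; zero; suc; pred; _+_)
import Data.Nat.Properties as ℕ
open import Data.Product.Base using (_×_; _,_; proj₁; proj₂; ∃; zip)
open import Data.Rational.Base as ℚ using (0ℚ)
import Data.Rational.Properties as ℚ
open import Data.Sign.Base as Sign using (Sign)
import Data.Sign.Properties as Sign
open import Data.Sum.Base using (_⊎_; inj₁; inj₂)
open import Data.Vec.Base using (Vec; []; _∷_; _++_; map; replicate)
import Data.Vec.Properties as Vec
open import Data.Vec.Relation.Unary.All as All using (All; []; _∷_)
import Data.Vec.Relation.Unary.All.Properties as All
open import Function.Base using (_∘_)
open import Function.Bundles using (Equivalence)
open import Level using (Level; _⊔_)
open import Relation.Binary.Bundles using (Poset)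
open import Relation.Binary.PropositionalEquality as ≡ using (_≡_)
import Relation.Binary.Reasoning.PartialOrder as ≼-Reasoning
import Relation.Binary.Reasoning.Setoid as ≈-Reasoning
open import Relation.Unary using (Pred)

private
  variable
    a b c ℓ ℓ₁ ℓ₂ : Level

-- Homomorphisms, partially ordered abelian groups and signs.

module _ (G : Group a ℓ₁) (H : Group b ℓ₂) where
  private
    module G = Group G
    module H = Group H
  open ≈-Reasoning H.setoid

  -- Additivity alone moves negation through a map. This serves each argument of `∗` and
  -- multiplication by a fixed scalar.
  ⁻¹-homo : ∀ {f} → (∀ {x y} → x G.≈ y → f x H.≈ f y) →
            Homomorphic₂ _ _ H._≈_ f G._∙_ H._∙_ →
            ∀ x → f (x G.⁻¹) H.≈ (f x) H.⁻¹
  ⁻¹-homo {f} f-cong ∙-homo x = GroupProperties.inverseˡ-unique H _ _ (begin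
    f (x G.⁻¹) H.∙ f x   ≈⟨ ∙-homo (x G.⁻¹) x ⟨
    f (x G.⁻¹ G.∙ x)     ≈⟨ f-cong (G.inverseˡ x) ⟩
    f G.ε                ≈⟨ GroupProperties.identityʳ-unique H _ _ (begin
      f G.ε H.∙ f G.ε      ≈⟨ ∙-homo G.ε G.ε ⟨
      f (G.ε G.∙ G.ε)      ≈⟨ f-cong (G.identityˡ G.ε) ⟩
      f G.ε                ∎) ⟩
    H.ε                  ∎)

module OrderedGroup {P : Poset c ℓ₁ ℓ₂} (G : PartiallyOrderedAbelianGroup P) where
  open PartiallyOrderedAbelianGroup G public

  abelianGroup : AbelianGroup _ _
  abelianGroup = record { isAbelianGroup = record { isGroup = isGroup ; comm = ⊕-comm } }

  open AbelianGroup abelianGroup public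
    using (group; refl; sym; trans; ∙-cong; ∙-congˡ; ∙-congʳ; assoc;
           identityˡ; identityʳ; inverseˡ; inverseʳ; ⁻¹-cong)
  open AbelianGroupProperties abelianGroup public
    using (⁻¹-involutive; ⁻¹-anti-homo‿-; xyx⁻¹≈y)
  open Poset P public
    using () renaming (refl to ≼-refl; trans to ≼-trans; reflexive to ≼-reflexive)
  open CommutativeSemigroupProperties (AbelianGroup.commutativeSemigroup abelianGroup)
    using (xy∙z≈xz∙y)
  open ≼-Reasoning P

  ⊕-monoˡ-≼ : ∀ z {x y} → x ≼ y → x ⊕ z ≼ y ⊕ z
  ⊕-monoˡ-≼ z = Equivalence.from (translateʳ⇔≼ _ _ z)

  ⊕-monoʳ-≼ : ∀ z {x y} → x ≼ y → z ⊕ x ≼ z ⊕ y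
  ⊕-monoʳ-≼ z {x} {y} x≼y = Equivalence.from (translateˡ⇔translateʳ x y z) (⊕-monoˡ-≼ z x≼y)

  ⊕-mono-≼ : ∀ {x y u v} → x ≼ y → u ≼ v → x ⊕ u ≼ y ⊕ v
  ⊕-mono-≼ x≼y u≼v = ≼-trans (⊕-monoˡ-≼ _ x≼y) (⊕-monoʳ-≼ _ u≼v)

  x⊕[y⊖x]≈y : ∀ x y → x ⊕ (y ⊖ x) ≈ y
  x⊕[y⊖x]≈y x y = trans (sym (assoc x y (⊝ x))) (xyx⁻¹≈y x y)

  [x⊖y]⊕[y⊖z]≈x⊖z : ∀ x y z → (x ⊖ y) ⊕ (y ⊖ z) ≈ x ⊖ z
  [x⊖y]⊕[y⊖z]≈x⊖z x y z = begin-equality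
    (x ⊖ y) ⊕ (y ⊖ z)    ≈⟨ assoc (x ⊖ y) y (⊝ z) ⟨
    (x ⊖ y) ⊕ y ⊖ z      ≈⟨ ∙-congʳ (assoc x (⊝ y) y) ⟩
    x ⊕ (⊝ y ⊕ y) ⊖ z    ≈⟨ ∙-congʳ (∙-congˡ (inverseˡ y)) ⟩
    x ⊕ 𝟎 ⊖ z            ≈⟨ ∙-congʳ (identityʳ x) ⟩
    x ⊖ z                ∎

  x≼y⇒𝟎≼y⊖x : ∀ {x y} → x ≼ y → 𝟎 ≼ y ⊖ x
  x≼y⇒𝟎≼y⊖x {x} {y} x≼y = begin
    𝟎      ≈⟨ inverseʳ x ⟨
    x ⊖ x  ≤⟨ ⊕-monoˡ-≼ (⊝ x) x≼y ⟩
    y ⊖ x  ∎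

  𝟎≼y⇒x≼x⊕y : ∀ {x y} → 𝟎 ≼ y → x ≼ x ⊕ y
  𝟎≼y⇒x≼x⊕y {x} {y} 𝟎≼y = begin
    x      ≈⟨ identityʳ x ⟨
    x ⊕ 𝟎  ≤⟨ ⊕-monoʳ-≼ x 𝟎≼y ⟩
    x ⊕ y  ∎

  y≽z⇒x⊖y≼x⊖z : ∀ x {y z} → y ≽ z → x ⊖ y ≼ x ⊖ z
  y≽z⇒x⊖y≼x⊖z x {y} {z} y≽z = begin
    x ⊖ y                ≤⟨ 𝟎≼y⇒x≼x⊕y (x≼y⇒𝟎≼y⊖x y≽z) ⟩
    (x ⊖ y) ⊕ (y ⊖ z)    ≈⟨ [x⊖y]⊕[y⊖z]≈x⊖z x y z ⟩
    x ⊖ z                ∎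

  -- Reduces every part of the theorem to bounding the negated middle term by the sum of the outer
  -- two.
  ⊝y≼x⊕z⇒𝟎≼x⊕y⊕z : ∀ {x y z} → ⊝ y ≼ x ⊕ z → 𝟎 ≼ x ⊕ y ⊕ z
  ⊝y≼x⊕z⇒𝟎≼x⊕y⊕z {x} {y} {z} ⊝y≼x⊕z = begin
    𝟎          ≈⟨ inverseˡ y ⟨
    ⊝ y ⊕ y    ≤⟨ ⊕-monoˡ-≼ y ⊝y≼x⊕z ⟩
    x ⊕ z ⊕ y  ≈⟨ xy∙z≈xz∙y x z y ⟩
    x ⊕ y ⊕ z  ∎

  -- Signs are kept as data, so that even and odd cases need no separate arguments.
  signed : Sign → Carrier → Carrier
  signed Sign.+ x = x
  signed Sign.- x = ⊝ x

  signed-cong : ∀ σ {x y} → x ≈ y → signed σ x ≈ signed σ y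
  signed-cong Sign.+ x≈y = x≈y
  signed-cong Sign.- x≈y = ⁻¹-cong x≈y

  signed-signed : ∀ σ τ x → signed σ (signed τ x) ≈ signed (σ Sign.* τ) x
  signed-signed Sign.+ τ      x = refl
  signed-signed Sign.- Sign.+ x = refl
  signed-signed Sign.- Sign.- x = ⁻¹-involutive x

-- Distributive products that preserve nonnegativity.

module DistributiveProduct
    {i iℓ io j jℓ jo k kℓ ko}
    {I : Poset i iℓ io} {J : Poset j jℓ jo} {K : Poset k kℓ ko}
    {GI : PartiallyOrderedAbelianGroup I} {GJ : PartiallyOrderedAbelianGroup J}
    {GK : PartiallyOrderedAbelianGroup K}
    {_∗_ : Poset.Carrier I → Poset.Carrier J → Poset.Carrier K}
    (is𝒞 : Is𝒞 GI GJ GK _∗_) where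
  open Is𝒞 is𝒞 public
  private
    module I = OrderedGroup GI
    module J = OrderedGroup GJ
    module K = OrderedGroup GK
  open ≼-Reasoning K

  ⊝-∗ˡ : ∀ x y → ((I.⊝ x) ∗ y) K.≈ (K.⊝ (x ∗ y))
  ⊝-∗ˡ x y = ⁻¹-homo I.group K.group (λ p → ∗-cong p J.refl) (λ u v → ∗-distribʳ u v y) x

  ⊝-∗ʳ : ∀ x y → (x ∗ (J.⊝ y)) K.≈ (K.⊝ (x ∗ y))
  ⊝-∗ʳ x = ⁻¹-homo J.group K.group (∗-cong I.refl) (∗-distribˡ x)

  signed-∗ˡ : ∀ σ x y → (I.signed σ x ∗ y) K.≈ K.signed σ (x ∗ y)
  signed-∗ˡ Sign.+ x y = K.refl
  signed-∗ˡ Sign.- x y = ⊝-∗ˡ x y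

  signed-∗ʳ : ∀ σ x y → (x ∗ J.signed σ y) K.≈ K.signed σ (x ∗ y)
  signed-∗ʳ Sign.+ x y = K.refl
  signed-∗ʳ Sign.- x y = ⊝-∗ʳ x y

  signed-∗ : ∀ σ τ x y → (I.signed σ x ∗ J.signed τ y) K.≈ K.signed (σ Sign.* τ) (x ∗ y)
  signed-∗ σ τ x y = begin-equality
    I.signed σ x ∗ J.signed τ y      ≈⟨ signed-∗ˡ σ x _ ⟩
    K.signed σ (x ∗ J.signed τ y)    ≈⟨ K.signed-cong σ (signed-∗ʳ τ x y) ⟩
    K.signed σ (K.signed τ (x ∗ y))  ≈⟨ K.signed-signed σ τ _ ⟩
    K.signed (σ Sign.* τ) (x ∗ y)    ∎

  -- Writing y as x plus the nonnegative y - x, distributivity turns the change into a nonnegative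
  -- summand.
  ∗-monoˡ-≼ : ∀ {x y z} → J.𝟎 J.≼ z → x I.≼ y → (x ∗ z) K.≼ (y ∗ z)
  ∗-monoˡ-≼ {x} {y} {z} 𝟎≼z x≼y = begin
    x ∗ z                              ≤⟨ K.𝟎≼y⇒x≼x⊕y (∗-nonNeg _ _ (I.x≼y⇒𝟎≼y⊖x x≼y) 𝟎≼z) ⟩
    (x ∗ z) K.⊕ ((y I.⊖ x) ∗ z)        ≈⟨ ∗-distribʳ x (y I.⊖ x) z ⟨
    (x I.⊕ (y I.⊖ x)) ∗ z              ≈⟨ ∗-cong (I.x⊕[y⊖x]≈y x y) J.refl ⟩
    y ∗ z                              ∎

  ∗-monoʳ-≼ : ∀ {x y z} → I.𝟎 I.≼ z → x J.≼ y → (z ∗ x) K.≼ (z ∗ y)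
  ∗-monoʳ-≼ {x} {y} {z} 𝟎≼z x≼y = begin
    z ∗ x                              ≤⟨ K.𝟎≼y⇒x≼x⊕y (∗-nonNeg _ _ 𝟎≼z (J.x≼y⇒𝟎≼y⊖x x≼y)) ⟩
    (z ∗ x) K.⊕ (z ∗ (y J.⊖ x))        ≈⟨ ∗-distribˡ z x (y J.⊖ x) ⟨
    z ∗ (x J.⊕ (y J.⊖ x))              ≈⟨ ∗-cong I.refl (J.x⊕[y⊖x]≈y x y) ⟩
    z ∗ y                              ∎

-- Real scalars and the inequality with real coefficients.

p≤∣p∣ : ∀ p → p ℚ.≤ ℚ.∣ p ∣
p≤∣p∣ p with ℚ.≤-total 0ℚ p
... | inj₁ 0≤p = ℚ.≤-reflexive (≡.sym (ℚ.0≤p⇒∣p∣≡p 0≤p))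
... | inj₂ p≤0 = ℚ.≤-trans p≤0 (ℚ.0≤∣p∣ p)

∣r∣≤s⇒r≤s : ∀ r s → ∣ r ∣ℝ ≤ℝ s → r ≤ℝ s
∣r∣≤s⇒r≤s r s ∣r∣≤s ε ε>0 with ∣r∣≤s ε ε>0
... | N , bound = N , λ n N≤n → ℚ.≤-trans (p≤∣p∣ (seq r n)) (bound n N≤n)

-- The order on `ℝ` is termwise up to ε from some index on, so subtracting `seq r n` keeps both ε
-- and that index.
r≤s⇒0≤s-r : ∀ r s → r ≤ℝ s → 0ℝ ≤ℝ s +ℝ (-ℝ r)
r≤s⇒0≤s-r r s r≤s ε ε>0 with r≤s ε ε>0
... | N , bound = N , λ n N≤n → begin
  0ℚ                                        ≡⟨ ℚ.+-inverseʳ (seq r n) ⟨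
  seq r n ℚ.- seq r n                       ≤⟨ ℚ.+-monoˡ-≤ (ℚ.- seq r n) (bound n N≤n) ⟩
  seq s n ℚ.+ ε ℚ.- seq r n                 ≡⟨ xy∙z≈xz∙y (seq s n) ε (ℚ.- seq r n) ⟩
  (seq s n ℚ.- seq r n) ℚ.+ ε               ∎
  where
  open ℚ.≤-Reasoning
  open CommutativeSemigroupProperties
    (CommutativeRing.+-commutativeSemigroup ℚ.+-*-commutativeRing) using (xy∙z≈xz∙y)

module OrderedVectorSpace
    {P : Poset c ℓ₁ ℓ₂} (G : PartiallyOrderedAbelianGroup P)
    {_·_ : ℝ → Poset.Carrier P → Poset.Carrier P}
    (isVectorSpace : IsPartiallyOrderedRealVectorSpace
      (PartiallyOrderedAbelianGroup.partiallyOrderedGroup G) _·_) where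
  open OrderedGroup G
  open IsPartiallyOrderedRealVectorSpace isVectorSpace
  open IsLeftModule isRealVectorSpace
  open ≼-Reasoning P
  private
    module ℝᴿ = CommutativeRing ℝ-commutativeRing

  ⊝-· : ∀ r x → (r · (⊝ x)) ≈ (⊝ (r · x))
  ⊝-· r = ⁻¹-homo group group (*ₗ-cong (ℝᴿ.refl {r})) (*ₗ-distribˡ r)

  -- The axioms give monotonicity in the vector only. For the scalar, split s as r + (s - r) and let
  -- the nonnegative s - r act on 𝟎 ≼ x.
  ·-monoˡ-≼ : ∀ r s {x} → 𝟎 ≼ x → r ≤ℝ s → (r · x) ≼ (s · x)
  ·-monoˡ-≼ r s {x} 𝟎≼x r≤s = begin
    r · x                                ≤⟨ 𝟎≼y⇒x≼x⊕y 𝟎≼d·x ⟩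
    (r · x) ⊕ ((s +ℝ (-ℝ r)) · x)        ≈⟨ *ₗ-distribʳ x r (s +ℝ (-ℝ r)) ⟨
    (r +ℝ (s +ℝ (-ℝ r))) · x             ≈⟨ *ₗ-cong r+[s-r]≈s refl ⟩
    s · x                                ∎
    where
    𝟎≼d·x : 𝟎 ≼ ((s +ℝ (-ℝ r)) · x)
    𝟎≼d·x = begin
      𝟎                    ≈⟨ *ₗ-zeroʳ (s +ℝ (-ℝ r)) ⟨
      (s +ℝ (-ℝ r)) · 𝟎    ≤⟨ ·-monoʳ _ 𝟎 x (r≤s⇒0≤s-r r s r≤s) 𝟎≼x ⟩
      (s +ℝ (-ℝ r)) · x    ∎
    r+[s-r]≈s : r +ℝ (s +ℝ (-ℝ r)) ℝᴿ.≈ s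
    r+[s-r]≈s = ℝᴿ.trans {r +ℝ (s +ℝ (-ℝ r))} {(r +ℝ s) +ℝ (-ℝ r)} {s}
      (ℝᴿ.sym {(r +ℝ s) +ℝ (-ℝ r)} {r +ℝ (s +ℝ (-ℝ r))} (ℝᴿ.+-assoc r s (-ℝ r)))
      (AbelianGroupProperties.xyx⁻¹≈y ℝᴿ.+-abelianGroup r s)

module _
    {i iℓ io k kℓ ko} {P : Poset i iℓ io} {Q : Poset k kℓ ko}
    {GI GJ : PartiallyOrderedAbelianGroup P} {GK : PartiallyOrderedAbelianGroup Q}
    {_∗_ : Poset.Carrier P → Poset.Carrier P → Poset.Carrier Q}
    {_·_ : ℝ → Poset.Carrier Q → Poset.Carrier Q}
    (is𝒞 : Is𝒞 GI GJ GK _∗_)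
    (isVectorSpace : IsPartiallyOrderedRealVectorSpace
      (PartiallyOrderedAbelianGroup.partiallyOrderedGroup GK) _·_) where
  private
    module I = OrderedGroup GI
    module J = OrderedGroup GJ
    module K = OrderedGroup GK
  open DistributiveProduct is𝒞
  open OrderedVectorSpace GK isVectorSpace
  open IsPartiallyOrderedRealVectorSpace isVectorSpace
  open IsLeftModule isRealVectorSpace
  open ≼-Reasoning Q
  private
    module ℝᴿ = CommutativeRing ℝ-commutativeRing

  schur-scalar : ∀ {x y z} → x I.≽ y → y I.≽ z →
    ∀ a b c → 0ℝ ≤ℝ a → 0ℝ ≤ℝ c → ∣ b ∣ℝ ≤ℝ a +ℝ c →
    ((a · ((x I.⊖ y) ∗ (x J.⊖ z)))
      K.⊕ (b · ((y I.⊖ x) ∗ (y J.⊖ z)))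
      K.⊕ (c · ((z I.⊖ x) ∗ (z J.⊖ y)))) K.≽ K.𝟎
  schur-scalar {x} {y} {z} x≽y y≽z a b c 0≤a 0≤c ∣b∣≤a+c = K.⊝y≼x⊕z⇒𝟎≼x⊕y⊕z (begin
    K.⊝ (b · ((y I.⊖ x) ∗ v))              ≈⟨ ⊝-· b _ ⟨
    b · (K.⊝ ((y I.⊖ x) ∗ v))              ≈⟨ *ₗ-cong (ℝᴿ.refl {b}) (⊝-∗ˡ (y I.⊖ x) v) ⟨
    -- In the middle term only the left factor is reversed, so it absorbs the minus sign.
    b · ((I.⊝ (y I.⊖ x)) ∗ v)              ≈⟨ *ₗ-cong (ℝᴿ.refl {b}) (∗-cong (I.⁻¹-anti-homo‿- y x) J.refl) ⟩
    b · w                                  ≤⟨ ·-monoˡ-≼ b (a +ℝ c) 𝟎≼w (∣r∣≤s⇒r≤s b (a +ℝ c) ∣b∣≤a+c) ⟩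
    (a +ℝ c) · w                           ≈⟨ *ₗ-distribʳ w a c ⟩
    (a · w) K.⊕ (c · w)                    ≤⟨ K.⊕-mono-≼ (·-monoʳ a _ _ 0≤a w≼₁) (·-monoʳ c _ _ 0≤c w≼₃) ⟩
    (a · (u ∗ (x J.⊖ z))) K.⊕ (c · ((z I.⊖ x) ∗ (z J.⊖ y))) ∎)
    where
    u = x I.⊖ y
    v = y J.⊖ z
    w = u ∗ v
    𝟎≼u : I.𝟎 I.≼ u
    𝟎≼u = I.x≼y⇒𝟎≼y⊖x x≽y
    𝟎≼v : J.𝟎 J.≼ v
    -- Both groups live on the same poset, so `y≽z` can also be translated by the addition of `J`.
    𝟎≼v = J.x≼y⇒𝟎≼y⊖x y≽z
    𝟎≼w : K.𝟎 K.≼ w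
    𝟎≼w = ∗-nonNeg u v 𝟎≼u 𝟎≼v
    w≼₁ : w K.≼ (u ∗ (x J.⊖ z))
    w≼₁ = ∗-monoʳ-≼ 𝟎≼u (J.⊕-monoˡ-≼ (J.⊝ z) x≽y)
    w≼₃ : w K.≼ ((z I.⊖ x) ∗ (z J.⊖ y))
    w≼₃ = begin
      w                                    ≤⟨ ∗-monoˡ-≼ 𝟎≼v (I.y≽z⇒x⊖y≼x⊖z x y≽z) ⟩
      -- Both factors of the third term are reversed, and the two signs cancel.
      (x I.⊖ z) ∗ v                        ≈⟨ signed-∗ Sign.- Sign.- _ _ ⟨
      (I.⊝ (x I.⊖ z)) ∗ (J.⊝ v)            ≈⟨ ∗-cong (I.⁻¹-anti-homo‿- x z) (J.⁻¹-anti-homo‿- y z) ⟩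
      (z I.⊖ x) ∗ (z J.⊖ y)                ∎

-- Bracketed products and invariants along a bracketing.

leaves-positive : ∀ {n} → Bracketing n → 0 ℕ.< n
leaves-positive leaf           = ℕ.s≤s ℕ.z≤n
leaves-positive (node {m} s t) = ℕ.≤-trans (leaves-positive s) (ℕ.m≤m+n m _)

-- Lets one product of triples be read off as three products with the same bracketing.
product-map : ∀ {A : Set a} {B : Set b} {_∘₁_ : Op₂ A} {_∘₂_ : Op₂ B} {f : A → B} →
              Homomorphic₂ _ _ _≡_ f _∘₁_ _∘₂_ →
              ∀ {n} (t : Bracketing n) xs → f (product _∘₁_ t xs) ≡ product _∘₂_ t (map f xs)
product-map homo leaf (x ∷ []) = ≡.refl
product-map {_∘₂_ = _∘₂_} {f} homo (node {m} s t) xs = ≡.trans (homo _ _) (≡.cong₂ _∘₂_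
  (≡.trans (product-map homo s _) (≡.cong (product _∘₂_ s) (≡.sym (Vec.take-map f m xs))))
  (≡.trans (product-map homo t _) (≡.cong (product _∘₂_ t) (≡.sym (Vec.drop-map f m xs)))))

-- Invariants H of products containing the first factor and T of products of
-- other factors, both graded by the number of other factors.
module Invariant {A : Set a} {_∗_ : Op₂ A} {H T : ℕ → Pred A ℓ}
    (H∗T : ∀ {m n x y} → H m x → T n y → H (m + n) (x ∗ y))
    (T∗T : ∀ {m n x y} → T m x → T n y → T (m + n) (x ∗ y)) where

  product-tail : ∀ {n} (t : Bracketing n) {xs} → All (T 1) xs → T n (product _∗_ t xs)
  product-tail leaf           {x ∷ []} (Tx ∷ []) = Tx
  product-tail (node {m} s t) Txs = T∗T (product-tail s (All.take⁺ m Txs)) (product-tail t (All.drop⁺ m Txs))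

  -- A bracketing can be matched on only when its index is a variable, so the
  -- nonemptiness of the vector is put into a predicate.
  private
    data Headed : ∀ {n} → Vec A n → Set (a ⊔ ℓ) where
      _∷_ : ∀ {x n} {xs : Vec A n} → H 0 x → All (T 1) xs → Headed (x ∷ xs)

    -- The first factor is the leftmost leaf, so at each node the left part is headed and the right
    -- part is a tail. `pred n` leaves that factor out of the count.
    product-headed : ∀ {n} (t : Bracketing n) {xs} → Headed xs → H (pred n) (product _∗_ t xs)
    product-headed leaf                (Hx ∷ []) = Hx
    product-headed (node {zero} s t)   _ = ⊥-elim (ℕ.n≮0 (leaves-positive s))
    product-headed (node {suc m} s t)  (Hx ∷ Txs) =
      H∗T (product-headed s (Hx ∷ All.take⁺ m Txs)) (product-tail t (All.drop⁺ m Txs))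

  product-head : ∀ {n} (t : Bracketing (suc n)) {x xs} → H 0 x → All (T 1) xs →
                 H n (product _∗_ t (x ∷ xs))
  product-head t Hx Txs = product-headed t (Hx ∷ Txs)

replicate⁺ : ∀ {A : Set a} {P : Pred A ℓ} {x} n → P x → All P (replicate n x)
replicate⁺ zero    px = []
replicate⁺ (suc n) px = px ∷ replicate⁺ n px

-- The inequalities with coefficients in the group itself.

module _ {i iℓ io} {P : Poset i iℓ io} {G : PartiallyOrderedAbelianGroup P}
    {_∗_ : Op₂ (Poset.Carrier P)} (is𝒞₂ : Is𝒞₂ G _∗_) where
  open OrderedGroup G
  open DistributiveProduct is𝒞₂
  open ≼-Reasoning P

  -- The invariants ignore the grade here: tails stay equal to e and heads to x. This settles
  -- exponent 0.
  product-identity : ∀ {e} → Identity _≈_ e _∗_ →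
                     ∀ {n} (t : Bracketing (suc n)) x {xs} → All (_≈ e) xs →
                     product _∗_ t (x ∷ xs) ≈ x
  product-identity {e} (idˡ , idʳ) t x = Invariant.product-head
    {H = λ _ → _≈ x} {T = λ _ → _≈ e}
    (λ {_} {_} y≈x z≈e → trans (∗-cong y≈x z≈e) (idʳ x))
    (λ y≈e z≈e → trans (∗-cong y≈e z≈e) (idˡ e))
    t refl

  Triple : Set i
  Triple = Carrier × Carrier × Carrier

  _∗³_ : Op₂ Triple
  _∗³_ = zip _∗_ (zip _∗_ _∗_)

  -- The three products run in parallel; σ is the sign that the third has
  -- collected, while the sign of the second is irrelevant because a + c bounds
  -- both b and − b.
  record Tail (σ : Sign) (p : Triple) : Set (i ⊔ iℓ ⊔ io) where
    constructor mkTail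
    private
      x = proj₁ p
      y = proj₁ (proj₂ p)
      z = proj₂ (proj₂ p)
    field
      {s z′} : Carrier
      {τ}    : Sign
      𝟎≼s    : 𝟎 ≼ s
      s≼x    : s ≼ x
      y≈±s   : y ≈ signed τ s
      z≈±z′  : z ≈ signed σ z′
      s≼z′   : s ≼ z′

  -- The hypothesis on (a, b, c), with the third entry taken up to the sign σ. The bound is required
  -- for both signs of β so that it survives a tail whose second entry has either sign.
  record Head (σ : Sign) (p : Triple) : Set (i ⊔ iℓ ⊔ io) where
    constructor mkHead
    private
      α = proj₁ p
      β = proj₁ (proj₂ p)
      γ = proj₂ (proj₂ p)
    field
      {γ′}    : Carrier
      𝟎≼α     : 𝟎 ≼ α
      γ≈±γ′   : γ ≈ signed σ γ′
      𝟎≼γ′    : 𝟎 ≼ γ′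
      ±β≼α⊕γ′ : ∀ τ → signed τ β ≼ α ⊕ γ′

  -- Up to sign, the second entry of a tail is a nonnegative s that lies below the other two. Such
  -- bounds multiply because `∗` is monotone on nonnegative elements.
  tail-∗ : ∀ {σ ρ p q} → Tail σ p → Tail ρ q → Tail (σ Sign.* ρ) (p ∗³ q)
  tail-∗ {σ} {ρ} (mkTail {τ = τ} 𝟎≼s s≼x y≈ z≈ s≼z′) (mkTail {τ = υ} 𝟎≼t t≼u v≈ w≈ t≼w′) = mkTail {τ = τ Sign.* υ}
    (∗-nonNeg _ _ 𝟎≼s 𝟎≼t)
    (≼-trans (∗-monoˡ-≼ 𝟎≼t s≼x) (∗-monoʳ-≼ (≼-trans 𝟎≼s s≼x) t≼u))
    (trans (∗-cong y≈ v≈) (signed-∗ τ υ _ _))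
    (trans (∗-cong z≈ w≈) (signed-∗ σ ρ _ _))
    (≼-trans (∗-monoˡ-≼ 𝟎≼t s≼z′) (∗-monoʳ-≼ (≼-trans 𝟎≼s s≼z′) t≼w′))

  -- The sign of the tail's second entry moves onto β. The bound on ±β is then multiplied by s, and
  -- after distributing, s is enlarged separately to x and to z′.
  head-∗ : ∀ {σ ρ p q} → Head σ p → Tail ρ q → Head (σ Sign.* ρ) (p ∗³ q)
  head-∗ {σ} {ρ} {α , β , γ} {x , y , z}
    (mkHead {γ′} 𝟎≼α γ≈ 𝟎≼γ′ ±β≼) (mkTail {s} {z′} {τ} 𝟎≼s s≼x y≈ z≈ s≼z′) = mkHead
    (∗-nonNeg _ _ 𝟎≼α (≼-trans 𝟎≼s s≼x))
    (trans (∗-cong γ≈ z≈) (signed-∗ σ ρ _ _))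
    (∗-nonNeg _ _ 𝟎≼γ′ (≼-trans 𝟎≼s s≼z′))
    λ υ → begin
      signed υ (β ∗ y)                  ≈⟨ signed-∗ˡ υ β y ⟨
      signed υ β ∗ y                    ≈⟨ ∗-cong refl y≈ ⟩
      signed υ β ∗ signed τ s           ≈⟨ signed-∗ υ τ β s ⟩
      signed (υ Sign.* τ) (β ∗ s)       ≈⟨ signed-∗ˡ (υ Sign.* τ) β s ⟨
      signed (υ Sign.* τ) β ∗ s         ≤⟨ ∗-monoˡ-≼ 𝟎≼s (±β≼ (υ Sign.* τ)) ⟩
      (α ⊕ γ′) ∗ s                      ≈⟨ ∗-distribʳ α γ′ s ⟩
      (α ∗ s) ⊕ (γ′ ∗ s)                ≤⟨ ⊕-mono-≼ (∗-monoʳ-≼ 𝟎≼α s≼x) (∗-monoʳ-≼ 𝟎≼γ′ s≼z′) ⟩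
      (α ∗ x) ⊕ (γ′ ∗ z′)               ∎

  head⇒𝟎≼ : ∀ {α β γ} → Head Sign.+ (α , β , γ) → 𝟎 ≼ α ⊕ β ⊕ γ
  head⇒𝟎≼ (mkHead _ γ≈γ′ _ ±β≼α⊕γ′) =
    ⊝y≼x⊕z⇒𝟎≼x⊕y⊕z (≼-trans (±β≼α⊕γ′ Sign.-) (≼-reflexive (∙-congˡ (sym γ≈γ′))))

  open Mult Sign.*-monoid using (×-homo-+; ×-homo-1) renaming (_×_ to _·ˢ_)

  -- Each tail contributes the sign σ to the third product. Their number k + k is even, so the
  -- collected sign is +.
  product-schur : ∀ σ {k} (t : Bracketing (suc (k + k))) {a b c} → Head Sign.+ (a , b , c) →
    ∀ {ps : Vec Triple (k + k)} → All (Tail σ) ps →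
    product _∗_ t (a ∷ map proj₁ ps)
      ⊕ product _∗_ t (b ∷ map (proj₁ ∘ proj₂) ps)
      ⊕ product _∗_ t (c ∷ map (proj₂ ∘ proj₂) ps) ≽ 𝟎
  product-schur σ {k} t {a} {b} {c} abc {ps} tails =
    ≡.subst (𝟎 ≼_)
      (≡.cong₂ _⊕_ (≡.cong₂ _⊕_ (component proj₁ λ _ _ → ≡.refl)
                                (component (proj₁ ∘ proj₂) λ _ _ → ≡.refl))
                   (component (proj₂ ∘ proj₂) λ _ _ → ≡.refl))
      (head⇒𝟎≼ (≡.subst (λ ρ → Head ρ _) even (product-head t abc (All.map single tails))))
    where
    -- Grade n stands for the sign σ to the power n, so adding grades multiplies signs.
    open Invariant {_∗_ = _∗³_} {H = λ n → Head (n ·ˢ σ)} {T = λ n → Tail (n ·ˢ σ)}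
      (λ {m} {n} Hx Ty → ≡.subst (λ ρ → Head ρ _) (≡.sym (×-homo-+ σ m n)) (head-∗ Hx Ty))
      (λ {m} {n} Tx Ty → ≡.subst (λ ρ → Tail ρ _) (≡.sym (×-homo-+ σ m n)) (tail-∗ Tx Ty))
    single : ∀ {p} → Tail σ p → Tail (1 ·ˢ σ) p
    single = ≡.subst (λ ρ → Tail ρ _) (≡.sym (×-homo-1 σ))
    even : (k + k) ·ˢ σ ≡ Sign.+
    even = ≡.trans (×-homo-+ σ k k) (Sign.s*s≡+ (k ·ˢ σ))
    component : (f : Triple → Carrier) → Homomorphic₂ _ _ _≡_ f _∗³_ _∗_ →
                f (product _∗³_ t ((a , b , c) ∷ ps)) ≡ product _∗_ t (map f ((a , b , c) ∷ ps))
    component f homo = product-map homo t _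

  module _ {x y z} (x≽y : x ≽ y) (y≽z : y ≽ z)
      {a b c} (𝟎≼a : 𝟎 ≼ a) (𝟎≼c : 𝟎 ≼ c)
      (upper : IsUpperBound P (λ s → (s ≈ b) ⊎ (s ≈ (⊝ b))) (a ⊕ c)) where
    private
      𝟎≼x⊖y : 𝟎 ≼ x ⊖ y
      𝟎≼x⊖y = x≼y⇒𝟎≼y⊖x x≽y
      𝟎≼y⊖z : 𝟎 ≼ y ⊖ z
      𝟎≼y⊖z = x≼y⇒𝟎≼y⊖x y≽z
      x⊖y≼x⊖z : x ⊖ y ≼ x ⊖ z
      x⊖y≼x⊖z = y≽z⇒x⊖y≼x⊖z x y≽z
      y⊖z≼x⊖z : y ⊖ z ≼ x ⊖ z
      y⊖z≼x⊖z = ⊕-monoˡ-≼ (⊝ z) x≽y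

      coefficients : Head Sign.+ (a , b , c)
      coefficients = mkHead 𝟎≼a refl 𝟎≼c λ where
        Sign.+ → upper b (inj₁ refl)
        Sign.- → upper (⊝ b) (inj₂ refl)

    -- For positive n every factor of the third product is a reversed difference, hence σ is -; the
    -- 2n signs cancel.
    schur-power : ∀ n (h : HasPower _≈_ _∗_ n) (t : Bracketing (1 + (width n + width n))) →
      let infix 9 _^n
          _^n = power _≈_ _∗_ n h in
      product _∗_ t (a ∷ (x ⊖ y) ^n ++ (x ⊖ z) ^n)
        ⊕ product _∗_ t (b ∷ (y ⊖ x) ^n ++ (y ⊖ z) ^n)
        ⊕ product _∗_ t (c ∷ (z ⊖ x) ^n ++ (z ⊖ y) ^n) ≽ 𝟎
    -- The identity of ∗ need not be nonnegative, so n = 0 does not fit the invariant.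
    schur-power zero (e , identity) t = begin
      𝟎          ≤⟨ ⊝y≼x⊕z⇒𝟎≼x⊕y⊕z (upper (⊝ b) (inj₂ refl)) ⟩
      a ⊕ b ⊕ c  ≈⟨ ∙-cong (∙-cong (collapse a) (collapse b)) (collapse c) ⟨
      _          ∎
      where
      collapse : ∀ d → product _∗_ t (d ∷ e ∷ e ∷ []) ≈ d
      collapse d = product-identity identity t d (refl ∷ refl ∷ [])
    schur-power n@(suc _) h t = ≡.subst (_≽ 𝟎)
      (≡.cong₂ _⊕_ (≡.cong₂ _⊕_ (factors a proj₁) (factors b (proj₁ ∘ proj₂)))
                   (factors c (proj₂ ∘ proj₂)))
      (product-schur Sign.- {n} t coefficients
        (All.++⁺ (replicate⁺ n tail₁) (replicate⁺ n tail₂)))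
      where
      p₁ p₂ : Triple
      p₁ = x ⊖ y , y ⊖ x , z ⊖ x
      p₂ = x ⊖ z , y ⊖ z , z ⊖ y
      -- The smallest difference in size serves as s: x - y for `p₁`, where the second entry is -s,
      -- and y - z for `p₂`, where it is s.
      tail₁ : Tail Sign.- p₁
      tail₁ = mkTail {τ = Sign.-} 𝟎≼x⊖y ≼-refl (sym (⁻¹-anti-homo‿- x y)) (sym (⁻¹-anti-homo‿- x z)) x⊖y≼x⊖z
      tail₂ : Tail Sign.- p₂
      tail₂ = mkTail {τ = Sign.+} 𝟎≼y⊖z y⊖z≼x⊖z refl (sym (⁻¹-anti-homo‿- y z)) ≼-refl
      factors : ∀ d f → product _∗_ t (d ∷ map f (replicate n p₁ ++ replicate n p₂)) ≡
                        product _∗_ t (d ∷ replicate n (f p₁) ++ replicate n (f p₂))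
      factors d f = ≡.cong (λ ds → product _∗_ t (d ∷ ds))
        (≡.trans (Vec.map-++ f (replicate n p₁) (replicate n p₂))
                 (≡.cong₂ _++_ (Vec.map-replicate f p₁ n) (Vec.map-replicate f p₂ n)))

    -- Monotonicity carries the comparisons of differences over to p, and the parity of p supplies
    -- σ. With two factors (k = 1) even and odd p are treated alike.
    schur-𝒢 : ∀ {p} → Is𝒢 partiallyOrderedGroup p → (t : Bracketing 3) →
      product _∗_ t (a ∷ p (x ⊖ y) ∷ p (x ⊖ z) ∷ [])
        ⊕ product _∗_ t (b ∷ p (y ⊖ x) ∷ p (y ⊖ z) ∷ [])
        ⊕ product _∗_ t (c ∷ p (z ⊖ x) ∷ p (z ⊖ y) ∷ []) ≽ 𝟎
    schur-𝒢 {p} is𝒢 t = product-schur σ {1} t coefficients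
      ( mkTail {τ = σ} (𝟎≼p 𝟎≼x⊖y) ≼-refl (p-swap y x) (p-swap z x) (p-mono _ _ x⊖y≼x⊖z 𝟎≼x⊖y)
      ∷ mkTail {τ = Sign.+} (𝟎≼p 𝟎≼y⊖z) (p-mono _ _ y⊖z≼x⊖z 𝟎≼y⊖z) refl (p-swap z y) ≼-refl
      ∷ [])
      where
      open Is𝒢 is𝒢
      𝟎≼p : ∀ {u} → 𝟎 ≼ u → 𝟎 ≼ p u
      -- p(u) ≽ p(0) ≽ 0, by monotonicity on the nonnegative elements.
      𝟎≼p 𝟎≼u = ≼-trans p0≽0 (p-mono _ 𝟎 𝟎≼u ≼-refl)

      signedParity : ∃ λ σ → ∀ u → p u ≈ signed σ (p (⊝ u))
      signedParity with parity
      ... | inj₁ even = Sign.+ , even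
      ... | inj₂ odd  = Sign.- , odd

      σ : Sign
      σ = proj₁ signedParity

      p-swap : ∀ u v → p (u ⊖ v) ≈ signed σ (p (v ⊖ u))
      p-swap u v = trans (proj₂ signedParity (u ⊖ v)) (signed-cong σ (p-cong (⁻¹-anti-homo‿- u v)))

theorem10 : ∀ {i iℓ io k kℓ ko} (n : ℕ) →
  -- (1)
  ( (P : Poset i iℓ io) (Q : Poset k kℓ ko)
    (GI GJ : PartiallyOrderedAbelianGroup P) (GK : PartiallyOrderedAbelianGroup Q)
    (_∗_ : Poset.Carrier P → Poset.Carrier P → Poset.Carrier Q)
    (_·_ : ℝ → Poset.Carrier Q → Poset.Carrier Q) →
    let module I = PartiallyOrderedAbelianGroup GI
        module J = PartiallyOrderedAbelianGroup GJ
        module K = PartiallyOrderedAbelianGroup GK in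
    Is𝒞 GI GJ GK _∗_ →
    IsPartiallyOrderedRealVectorSpace K.partiallyOrderedGroup _·_ →
    ∀ x y z → x I.≽ y → y I.≽ z →
    ∀ a b c → 0ℝ ≤ℝ a → 0ℝ ≤ℝ c → ∣ b ∣ℝ ≤ℝ a +ℝ c →
    ( (a · ((x I.⊖ y) ∗ (x J.⊖ z)))
      K.⊕ (b · ((y I.⊖ x) ∗ (y J.⊖ z)))
      K.⊕ (c · ((z I.⊖ x) ∗ (z J.⊖ y))) ) K.≽ K.𝟎 )
  ×
  -- (2)
  ( (P : Poset i iℓ io) (G : PartiallyOrderedAbelianGroup P) (_∗_ : Op₂ (Poset.Carrier P)) →
    let open PartiallyOrderedAbelianGroup G in
    Is𝒞₂ G _∗_ →
    ∀ x y z → x ≽ y → y ≽ z →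
    ∀ a b c → a ≽ 𝟎 → c ≽ 𝟎 → IsUpperBound P (λ s → (s ≈ b) ⊎ (s ≈ (⊝ b))) (a ⊕ c) →
    (h : HasPower _≈_ _∗_ n) (t : Bracketing (1 + (width n + width n))) →
    let infix 9 _^n
        _^n = power _≈_ _∗_ n h in
    ( product _∗_ t (a ∷ (x ⊖ y) ^n ++ (x ⊖ z) ^n)
      ⊕ product _∗_ t (b ∷ (y ⊖ x) ^n ++ (y ⊖ z) ^n)
      ⊕ product _∗_ t (c ∷ (z ⊖ x) ^n ++ (z ⊖ y) ^n) ) ≽ 𝟎 )
  ×
  -- (3)
  ( (P : Poset i iℓ io) (G : PartiallyOrderedAbelianGroup P) (_∗_ : Op₂ (Poset.Carrier P))
    (_·_ : ℝ → Poset.Carrier P → Poset.Carrier P) →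
    let open PartiallyOrderedAbelianGroup G in
    Is𝒞₂ G _∗_ →
    IsPartiallyOrderedRealVectorSpace partiallyOrderedGroup _·_ →
    ∀ x y z → x ≽ y → y ≽ z →
    ∀ a b c → a ≽ 𝟎 → c ≽ 𝟎 → IsUpperBound P (λ s → (s ≈ b) ⊎ (s ≈ (⊝ b))) (a ⊕ c) →
    (p : Op₁ (Poset.Carrier P)) → Is𝒢 partiallyOrderedGroup p →
    (t : Bracketing 3) →
    ( product _∗_ t (a ∷ p (x ⊖ y) ∷ p (x ⊖ z) ∷ [])
      ⊕ product _∗_ t (b ∷ p (y ⊖ x) ∷ p (y ⊖ z) ∷ [])
      ⊕ product _∗_ t (c ∷ p (z ⊖ x) ∷ p (z ⊖ y) ∷ []) ) ≽ 𝟎 )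
theorem10 n =
  (λ _ _ _ _ _ _ _ is𝒞 isVectorSpace _ _ _ x≽y y≽z →
    schur-scalar is𝒞 isVectorSpace x≽y y≽z) ,
  (λ _ _ _ is𝒞₂ _ _ _ x≽y y≽z _ _ _ 𝟎≼a 𝟎≼c upper →
    schur-power is𝒞₂ x≽y y≽z 𝟎≼a 𝟎≼c upper n) ,
  (λ _ _ _ _ is𝒞₂ _ _ _ _ x≽y y≽z _ _ _ 𝟎≼a 𝟎≼c upper _ →
    schur-𝒢 is𝒞₂ x≽y y≽z 𝟎≼a 𝟎≼c upper)
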